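{- Let $n$ be a composite positive integer. Then there exists a normalized Latin square of size $n$ with entries in $\{1,\dots,n\}$ that is singular (its determinant as a real matrix is $0$).
   Context: A Latin square of size $n$ with entries in $\{1,\dots,n\}$ is an $n\times n$ matrix in which each of $1,\dots,n$ occurs exactly once in each row and each column; it is normalized if its first column is $(1,2,\dots,n)^T$. It is singular if it is not invertible as a real matrix. -}

module Defs where

open import Data.Fin.Base using (Fin; zero; suc; toℕ; punchIn)
open import Data.Integer.Base using (ℤ; +_; _*_; _^_; 0ℤ; 1ℤ; -1ℤ; +-0-rawMonoid)
open import Data.Nat.Base using (ℕ; zero; suc; _≤_)
open import Data.Product using (_×_; ∃!)
open import Data.Vec.Functional using (Vector)
open import Algebra.Definitions.RawMonoid +-0-rawMonoid using (sum)
open import Relation.Binary.PropositionalEquality.Core using (_≡_)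

Matrix : Set → ℕ → Set
Matrix A n = Vector (Vector A n) n

-- Row and column indices run over 0, …, n-1; the entries are genuine values
-- in {1, …, n}.
record IsLatinSquare {n : ℕ} (L : Matrix ℕ n) : Set where
  field
    entries : ∀ i j → 1 ≤ L i j × L i j ≤ n
    rows    : ∀ i k → 1 ≤ k → k ≤ n → ∃! _≡_ (λ j → L i j ≡ k)
    columns : ∀ j k → 1 ≤ k → k ≤ n → ∃! _≡_ (λ i → L i j ≡ k)

-- The first column is the one with index 0, and its row-i entry is i + 1 since
-- indices start at 0.
IsNormalized : ∀ {n} → Matrix ℕ n → Set
IsNormalized L = ∀ i j → toℕ j ≡ 0 → L i j ≡ suc (toℕ i)

minor : ∀ {A n} → Matrix A (suc n) → Fin (suc n) → Fin (suc n) → Matrix A n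
minor M i j r c = M (punchIn i r) (punchIn j c)

-- Laplace expansion along the first row.
det : ∀ {n} → Matrix ℤ n → ℤ
det {zero}  M = 1ℤ
det {suc n} M = sum (λ j → -1ℤ ^ toℕ j * (M zero j * det (minor M zero j)))

-- For an integer matrix the real determinant is the image of the integer
-- determinant under the injection ℤ → ℝ, so it vanishes iff the latter does.
IsSingular : ∀ {n} → Matrix ℕ n → Set
IsSingular L = det (λ i j → + L i j) ≡ 0ℤ

-- If n = ab with a, b ≥ 2, number the elements of ℤ/a × ℤ/b by (u , v) ↦ bu + v
-- and take the addition table of this group, shifted by 1.  Its entry in row
-- (i , k) and column (u , v) is b(i + u mod a) + (k + v mod b) + 1, a function of
-- u plus a function of v, so the columns satisfy
-- (0,0) + (1,1) = (0,1) + (1,0).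

module Submission where

open import Data.Empty using (⊥-elim)
open import Data.Fin.Base
  using (Fin; zero; suc; toℕ; fromℕ<; inject₁; punchIn; _↑ʳ_; combine; remQuot)
open import Data.Fin.Induction using (<-weakInduction)
open import Data.Fin.Properties
  using (toℕ-injective; toℕ-fromℕ<; toℕ<n; toℕ≤n; toℕ-combine; remQuot-combine; combine-remQuot)
open import Data.Integer.Base as ℤ using (ℤ; +_; 0ℤ; -1ℤ)
import Data.Integer.Properties as ℤₚ
open import Data.Integer.Tactic.RingSolver using (solve-∀)
open import Data.Nat.Base as ℕ using (ℕ; zero; suc; 2+; s≤s; z≤n; _∸_; _%_)
open import Data.Nat.Divisibility using (divides; hasNonTrivialDivisor)
open import Data.Nat.DivMod
  using (m%n<n; m%n%n≡m%n; m<n⇒m%n≡m; [m+n]%n≡m%n; %-distribˡ-+)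
open import Data.Nat.Primality using (Composite)
import Data.Nat.Properties as ℕₚ
import Data.Nat.Tactic.RingSolver as ℕSolver
open import Data.Product.Base using (Σ; _×_; _,_; proj₁; proj₂)
open import Data.Sum.Base using (_⊎_; inj₁; inj₂)
open import Data.Vec.Functional using (Vector; _∷_)
open import Function.Base using (_∘_)
open import Relation.Binary.PropositionalEquality
  using (_≡_; _≢_; _≗_; refl; sym; trans; cong; cong₂; module ≡-Reasoning)
open import Algebra.Properties.Semiring.Sum ℤₚ.+-*-semiring
  using (sum; sum-cong-≗; ∑-distrib-+)
open import Defs

private
  variable
    A : Set
    m n : ℕ

-- Determinants and adjacent column swaps

-- The transposition of the adjacent positions `inject₁ p` and `suc p`. Indexing by `p` builds
-- adjacency into the type, and the recursion follows that of `punchIn`.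
swap : Fin n → Fin (suc n) → Fin (suc n)
swap zero    zero          = suc zero
swap zero    (suc zero)    = zero
swap zero    (suc (suc j)) = suc (suc j)
swap (suc p) zero          = zero
swap (suc p) (suc j)       = suc (swap p j)

swap-inject₁ : (p : Fin n) → swap p (inject₁ p) ≡ suc p
swap-inject₁ zero    = refl
swap-inject₁ (suc p) = cong suc (swap-inject₁ p)

swap-invariant : (f : Vector A (suc n)) (p : Fin n) →
  f (inject₁ p) ≡ f (suc p) → f ∘ swap p ≗ f
swap-invariant f zero    eq zero          = sym eq
swap-invariant f zero    eq (suc zero)    = eq
swap-invariant f zero    eq (suc (suc j)) = refl
swap-invariant f (suc p) eq zero          = refl
swap-invariant f (suc p) eq (suc j)       = swap-invariant (f ∘ suc) p eq j

-- If j is a swapped position, then deleting column j after the swap is deleting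
-- column swap p j before it; otherwise the swap descends to the minor.
swap-punchIn : (p : Fin (suc n)) (j : Fin (2+ n)) →
  (-1ℤ ℤ.^ toℕ j ≡ ℤ.- (-1ℤ ℤ.^ toℕ (swap p j))
    × (∀ c → swap p (punchIn j c) ≡ punchIn (swap p j) c))
  ⊎ (swap p j ≡ j × Σ (Fin n) λ q → ∀ c → swap p (punchIn j c) ≡ punchIn j (swap q c))
swap-punchIn zero zero = inj₁ (refl , λ { zero → refl ; (suc c) → refl })
swap-punchIn zero (suc zero) = inj₁ (refl , λ { zero → refl ; (suc c) → refl })
swap-punchIn {suc n} zero (suc (suc j)) =
  inj₂ (refl , zero , λ { zero → refl ; (suc zero) → refl ; (suc (suc c)) → refl })
swap-punchIn {suc n} (suc p) zero = inj₂ (refl , p , λ c → refl)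
swap-punchIn {suc n} (suc p) (suc j) with swap-punchIn p j
... | inj₁ (sign , eq) = inj₁
  ( trans (cong (-1ℤ ℤ.*_) sign) (sym (ℤₚ.neg-distribʳ-* -1ℤ (-1ℤ ℤ.^ toℕ (swap p j))))
  , λ { zero → refl ; (suc c) → cong suc (eq c) })
... | inj₂ (fix , q , eq) = inj₂
  (cong suc fix , suc q , λ { zero → refl ; (suc c) → cong suc (eq c) })

sum-swap : (t : Vector ℤ (suc n)) (p : Fin n) → sum (t ∘ swap p) ≡ sum t
sum-swap {suc n} t zero = exchange (t zero) (t (suc zero)) (sum {n} λ j → t (suc (suc j)))
  where
  exchange : ∀ x y z → y ℤ.+ (x ℤ.+ z) ≡ x ℤ.+ (y ℤ.+ z)
  exchange = solve-∀
sum-swap {suc n} t (suc p) = cong (ℤ._+_ (t zero)) (sum-swap (t ∘ suc) p)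

sum-neg : (t : Vector ℤ n) → sum (ℤ.-_ ∘ t) ≡ ℤ.- sum t
sum-neg {zero}  t = refl
sum-neg {suc n} t = trans (cong (ℤ._+_ (ℤ.- t zero)) (sum-neg (t ∘ suc)))
                          (sym (ℤₚ.neg-distrib-+ (t zero) (sum (t ∘ suc))))

det-cong : {M N : Matrix ℤ n} → (∀ i j → M i j ≡ N i j) → det M ≡ det N
det-cong {zero}  eq = refl
det-cong {suc n} eq = sum-cong-≗ λ j → cong (-1ℤ ℤ.^ toℕ j ℤ.*_)
  (cong₂ ℤ._*_ (eq zero j) (det-cong λ r c → eq (suc r) (punchIn j c)))

laplaceTerm : Matrix ℤ (suc n) → Vector ℤ (suc n)
laplaceTerm M j = -1ℤ ℤ.^ toℕ j ℤ.* (M zero j ℤ.* det (minor M zero j))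

-- Induction on the size, matching term `j` of the swapped expansion with term `swap p j` of the
-- original. At a swapped position the minors agree and the sign flips, the two positions being
-- adjacent; elsewhere the sign stays and the minor is negated by induction.
det-swap : (M : Matrix ℤ (suc n)) (p : Fin n) → det (λ i → M i ∘ swap p) ≡ ℤ.- det M
det-swap {suc n} M p = begin
  sum (laplaceTerm (λ i → M i ∘ swap p))  ≡⟨ sum-cong-≗ term ⟩
  sum (ℤ.-_ ∘ laplaceTerm M ∘ swap p)     ≡⟨ sum-neg (laplaceTerm M ∘ swap p) ⟩
  ℤ.- sum (laplaceTerm M ∘ swap p)        ≡⟨ cong ℤ.-_ (sum-swap (laplaceTerm M) p) ⟩
  ℤ.- sum (laplaceTerm M)                 ∎
  where
  open ≡-Reasoning

  neg-out : ∀ s x d → s ℤ.* (x ℤ.* ℤ.- d) ≡ ℤ.- (s ℤ.* (x ℤ.* d))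
  neg-out = solve-∀

  term : ∀ j → laplaceTerm (λ i → M i ∘ swap p) j ≡ ℤ.- laplaceTerm M (swap p j)
  term j with swap-punchIn p j
  ... | inj₁ (sign , eq) = trans
    (cong₂ (λ s d → s ℤ.* (M zero (swap p j) ℤ.* d)) sign
      (det-cong λ r c → cong (M (suc r)) (eq c)))
    (sym (ℤₚ.neg-distribˡ-* (-1ℤ ℤ.^ toℕ (swap p j)) _))
  ... | inj₂ (fix , q , eq) rewrite fix = trans
    (cong (λ d → -1ℤ ℤ.^ toℕ j ℤ.* (M zero j ℤ.* d))
      (trans (det-cong λ r c → cong (M (suc r)) (eq c)) (det-swap (minor M zero j) q)))
    (neg-out (-1ℤ ℤ.^ toℕ j) (M zero j) (det (minor M zero j)))

i≡-i⇒i≡0 : {i : ℤ} → i ≡ ℤ.- i → i ≡ 0ℤ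
-- For nonzero `i` the two sides have different head constructors, so only this case remains.
i≡-i⇒i≡0 {+ zero} _ = refl

-- Adjacent swaps carry the copy of column 0 leftwards to position 1, where one more swap fixes the
-- matrix yet negates its determinant.
det-equal-columns : (j : Fin (suc n)) → j ≢ zero → (M : Matrix ℤ (suc n)) →
  (∀ i → M i zero ≡ M i j) → det M ≡ 0ℤ
det-equal-columns {n} = <-weakInduction
  (λ j → j ≢ zero → (M : Matrix ℤ (suc n)) → (∀ i → M i zero ≡ M i j) → det M ≡ 0ℤ)
  (λ 0≢0 → ⊥-elim (0≢0 refl)) step
  where
  step : (p : Fin n) →
    (inject₁ p ≢ zero → (M : Matrix ℤ (suc n)) →
      (∀ i → M i zero ≡ M i (inject₁ p)) → det M ≡ 0ℤ) →
    suc p ≢ zero → (M : Matrix ℤ (suc n)) →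
    (∀ i → M i zero ≡ M i (suc p)) → det M ≡ 0ℤ
  step zero ih _ M eq = i≡-i⇒i≡0
    (trans (sym (det-cong λ i → swap-invariant (M i) zero (eq i))) (det-swap M zero))
  -- This swap moves column `suc (suc p)` to position `inject₁ (suc p)` and fixes column 0, so `ih`
  -- applies to the result.
  step (suc p) ih _ M eq = ℤₚ.neg-injective
    (trans (sym (det-swap M (suc p)))
      (ih (λ ()) (λ i → M i ∘ swap (suc p))
        λ i → trans (eq i) (cong (M i) (sym (swap-inject₁ (suc p))))))

-- Additivity in the first column

infixr 5 _▹_

_▹_ : Vector ℤ m → (Fin m → Vector ℤ n) → Fin m → Vector ℤ (suc n)
(x ▹ N) i = x i ∷ N i

minor-▹ : (x : Vector ℤ (2+ n)) (N : Fin (2+ n) → Vector ℤ (suc n)) (j : Fin (suc n)) →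
  ∀ r c → minor (x ▹ N) zero (suc j) r c ≡ (x ∘ suc ▹ λ i → N (suc i) ∘ punchIn j) r c
minor-▹ x N j r zero    = refl
minor-▹ x N j r (suc c) = refl

-- The expansion runs along the first row, so the split column enters in two ways: term 0 has the
-- sum as its coefficient, and each later term has it in the first column of its minor, where
-- induction on the size applies.
det-additive : (x y : Vector ℤ (suc n)) (N : Fin (suc n) → Vector ℤ n) →
  det ((λ i → x i ℤ.+ y i) ▹ N) ≡ det (x ▹ N) ℤ.+ det (y ▹ N)
det-additive {n} x y N = trans
  (sum-cong-≗ term)
  (∑-distrib-+ (laplaceTerm (x ▹ N)) (laplaceTerm (y ▹ N)))
  where
  distribˡ : ∀ s x y d → s ℤ.* ((x ℤ.+ y) ℤ.* d) ≡ s ℤ.* (x ℤ.* d) ℤ.+ s ℤ.* (y ℤ.* d)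
  distribˡ = solve-∀

  distribʳ : ∀ s z d e → s ℤ.* (z ℤ.* (d ℤ.+ e)) ≡ s ℤ.* (z ℤ.* d) ℤ.+ s ℤ.* (z ℤ.* e)
  distribʳ = solve-∀

  minor-additive : ∀ {n} (x y : Vector ℤ (suc n)) (N : Fin (suc n) → Vector ℤ n) (j : Fin n) →
    det (minor ((λ i → x i ℤ.+ y i) ▹ N) zero (suc j))
      ≡ det (minor (x ▹ N) zero (suc j)) ℤ.+ det (minor (y ▹ N) zero (suc j))
  -- The index `j` forces the minor to have at least one column, so it is again of the form `_▹_`.
  minor-additive {suc n} x y N j = trans
    (det-cong (minor-▹ (λ i → x i ℤ.+ y i) N j))
    (trans (det-additive (x ∘ suc) (y ∘ suc) (λ i → N (suc i) ∘ punchIn j))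
      (sym (cong₂ ℤ._+_ (det-cong (minor-▹ x N j)) (det-cong (minor-▹ y N j)))))

  term : ∀ j → laplaceTerm ((λ i → x i ℤ.+ y i) ▹ N) j
    ≡ laplaceTerm (x ▹ N) j ℤ.+ laplaceTerm (y ▹ N) j
  term zero = distribˡ ℤ.1ℤ (x zero) (y zero) (det (λ r c → N (suc r) c))
  term (suc j) = trans
    (cong (λ d → -1ℤ ℤ.^ toℕ (suc j) ℤ.* (N zero j ℤ.* d)) (minor-additive x y N j))
    (distribʳ (-1ℤ ℤ.^ toℕ (suc j)) (N zero j) _ _)

-- All columns but the first stay fixed. Putting a copy of a later column in front gives determinant
-- 0, so the one with `col (suc r)` can be added at no cost. Additivity merges the two first
-- columns, the hypothesis rewrites their sum, and splitting it again leaves two determinants that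
-- vanish likewise.
det-dependent-columns : (M : Matrix ℤ (suc n)) (p q r : Fin n) →
  (∀ i → M i zero ℤ.+ M i (suc r) ≡ M i (suc p) ℤ.+ M i (suc q)) → det M ≡ 0ℤ
det-dependent-columns {n} M p q r eq = begin
  det M                                                ≡⟨ det-cong M≗col▹N ⟩
  det (col zero ▹ N)                                   ≡⟨ ℤₚ.+-identityʳ _ ⟨
  det (col zero ▹ N) ℤ.+ 0ℤ                            ≡⟨ cong (ℤ._+_ (det (col zero ▹ N))) (repeated r) ⟨
  det (col zero ▹ N) ℤ.+ det (col (suc r) ▹ N)         ≡⟨ det-additive (col zero) (col (suc r)) N ⟨
  det ((λ i → col zero i ℤ.+ col (suc r) i) ▹ N)       ≡⟨ det-cong same ⟩
  det ((λ i → col (suc p) i ℤ.+ col (suc q) i) ▹ N)    ≡⟨ det-additive (col (suc p)) (col (suc q)) N ⟩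
  det (col (suc p) ▹ N) ℤ.+ det (col (suc q) ▹ N)      ≡⟨ cong₂ ℤ._+_ (repeated p) (repeated q) ⟩
  0ℤ                                                   ∎
  where
  open ≡-Reasoning

  col : Fin (suc n) → Vector ℤ (suc n)
  col j i = M i j

  N : Fin (suc n) → Vector ℤ n
  N i = M i ∘ suc

  M≗col▹N : ∀ i j → M i j ≡ (col zero ▹ N) i j
  M≗col▹N i zero    = refl
  M≗col▹N i (suc j) = refl

  repeated : ∀ k → det (col (suc k) ▹ N) ≡ 0ℤ
  repeated k = det-equal-columns (suc k) (λ ()) (col (suc k) ▹ N) λ i → refl

  same : ∀ i j → ((λ i → col zero i ℤ.+ col (suc r) i) ▹ N) i j
    ≡ ((λ i → col (suc p) i ℤ.+ col (suc q) i) ▹ N) i j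
  same i zero    = eq i
  same i (suc j) = refl

-- Latin squares from commutative quasigroups

module _ (_∙_ _\\_ : Fin n → Fin n → Fin n)
         (∙-comm : ∀ i j → i ∙ j ≡ j ∙ i)
         (∙-\\ : ∀ i k → i ∙ (i \\ k) ≡ k)
         (\\-∙ : ∀ i j → i \\ (i ∙ j) ≡ j)
         where

  table : Matrix ℕ n
  table i j = suc (toℕ (i ∙ j))

  -- Left division finds the unique position of a value in a row; commutativity makes the table
  -- symmetric, which reduces columns to rows.
  table-isLatinSquare : IsLatinSquare table
  table-isLatinSquare = record
    { entries = λ i j → s≤s z≤n , toℕ<n (i ∙ j)
    -- The value `suc k` corresponds to the index `k`, and `suc k ≤ n` is by definition `k < n`.
    ; rows    = λ { i (suc k) _ k<n → row i k k<n }
    ; columns = λ { j (suc k) _ k<n → let x , eq , unique = row j k k<n in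
        x , trans (cong (suc ∘ toℕ) (∙-comm x j)) eq
          , λ {y} eq′ → unique (trans (cong (suc ∘ toℕ) (∙-comm j y)) eq′) }
    }
    where
    row : ∀ i k → k ℕ.< n →
      Σ (Fin n) λ j → table i j ≡ suc k × (∀ {j′} → table i j′ ≡ suc k → j ≡ j′)
    row i k k<n = i \\ fromℕ< k<n
      , cong suc (trans (cong toℕ (∙-\\ i (fromℕ< k<n))) (toℕ-fromℕ< k<n))
      , λ {j′} eq → trans
          (cong (i \\_) (toℕ-injective (trans (toℕ-fromℕ< k<n) (sym (ℕₚ.suc-injective eq)))))
          (\\-∙ i j′)

-- Addition modulo n

residue : ℕ → Fin (suc n)
residue {n} x = fromℕ< (m%n<n x (suc n))

toℕ-residue : ∀ x → toℕ (residue {n} x) ≡ x % suc n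
toℕ-residue {n} x = toℕ-fromℕ< (m%n<n x (suc n))

residue-toℕ : (i : Fin (suc n)) → residue (toℕ i) ≡ i
residue-toℕ i = toℕ-injective (trans (toℕ-residue (toℕ i)) (m<n⇒m%n≡m (toℕ<n i)))

residue-+ : ∀ x y → residue {n} (x ℕ.+ toℕ (residue {n} y)) ≡ residue (x ℕ.+ y)
residue-+ {n} x y = toℕ-injective (begin
  toℕ (residue (x ℕ.+ toℕ (residue {n} y)))   ≡⟨ toℕ-residue (x ℕ.+ toℕ (residue {n} y)) ⟩
  (x ℕ.+ toℕ (residue {n} y)) % d             ≡⟨ cong (λ z → (x ℕ.+ z) % d) (toℕ-residue y) ⟩
  (x ℕ.+ y % d) % d                           ≡⟨ %-distribˡ-+ x (y % d) d ⟩
  (x % d ℕ.+ y % d % d) % d                   ≡⟨ cong (λ z → (x % d ℕ.+ z) % d) (m%n%n≡m%n y d) ⟩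
  (x % d ℕ.+ y % d) % d                       ≡⟨ %-distribˡ-+ x y d ⟨
  (x ℕ.+ y) % d                               ≡⟨ toℕ-residue (x ℕ.+ y) ⟨
  toℕ (residue {n} (x ℕ.+ y))                 ∎)
  where
  open ≡-Reasoning
  d = suc n

residue-+n : ∀ x → residue {n} (x ℕ.+ suc n) ≡ residue x
residue-+n {n} x = toℕ-injective
  (trans (toℕ-residue (x ℕ.+ suc n)) (trans ([m+n]%n≡m%n x (suc n)) (sym (toℕ-residue {n} x))))

infixl 6 _⊕_ _⊖_

_⊕_ : Fin (suc n) → Fin (suc n) → Fin (suc n)
i ⊕ j = residue (toℕ i ℕ.+ toℕ j)

-- `suc n ∸ toℕ i` represents the negative of `i`; the subtraction is never truncated, as
-- `toℕ i ≤ n`.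
_⊖_ : Fin (suc n) → Fin (suc n) → Fin (suc n)
_⊖_ {n} k i = residue ((suc n ∸ toℕ i) ℕ.+ toℕ k)

⊕-comm : (i j : Fin (suc n)) → i ⊕ j ≡ j ⊕ i
⊕-comm i j = cong residue (ℕₚ.+-comm (toℕ i) (toℕ j))

⊕-identityʳ : (i : Fin (suc n)) → i ⊕ zero ≡ i
⊕-identityʳ i = trans (cong residue (ℕₚ.+-identityʳ (toℕ i))) (residue-toℕ i)

-- The common core of both division laws: `x` and `y` are opposite modulo `suc n`, and either of
-- them may be the one that comes from `i`.
residue-cancel : ∀ x y (k : Fin (suc n)) → x ℕ.+ y ≡ suc n →
  residue (x ℕ.+ toℕ (residue {n} (y ℕ.+ toℕ k))) ≡ k
residue-cancel {n} x y k eq = begin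
  residue (x ℕ.+ toℕ (residue {n} (y ℕ.+ toℕ k)))  ≡⟨ residue-+ x (y ℕ.+ toℕ k) ⟩
  residue (x ℕ.+ (y ℕ.+ toℕ k))                    ≡⟨ cong residue (ℕₚ.+-assoc x y (toℕ k)) ⟨
  residue (x ℕ.+ y ℕ.+ toℕ k)                      ≡⟨ cong (λ z → residue (z ℕ.+ toℕ k)) eq ⟩
  residue (suc n ℕ.+ toℕ k)                        ≡⟨ cong residue (ℕₚ.+-comm (suc n) (toℕ k)) ⟩
  residue (toℕ k ℕ.+ suc n)                        ≡⟨ residue-+n (toℕ k) ⟩
  residue (toℕ k)                                  ≡⟨ residue-toℕ k ⟩
  k                                                ∎
  where open ≡-Reasoning

⊕-⊖ : (i k : Fin (suc n)) → i ⊕ (k ⊖ i) ≡ k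
⊕-⊖ i k = residue-cancel (toℕ i) _ k (ℕₚ.m+[n∸m]≡n (toℕ≤n i))

⊖-⊕ : (i j : Fin (suc n)) → i ⊕ j ⊖ i ≡ j
⊖-⊕ i j = residue-cancel _ (toℕ i) j (ℕₚ.m∸n+n≡m (toℕ≤n i))

-- The group ℤ/a × ℤ/b

module Product (a b : ℕ) where

  quot : Fin (2+ a ℕ.* 2+ b) → Fin (2+ a)
  quot = proj₁ ∘ remQuot (2+ b)

  rem : Fin (2+ a ℕ.* 2+ b) → Fin (2+ b)
  rem = proj₂ ∘ remQuot {2+ a} (2+ b)

  infixl 6 _⊞_ _⊟_

  _⊞_ _⊟_ : (i j : Fin (2+ a ℕ.* 2+ b)) → Fin (2+ a ℕ.* 2+ b)
  i ⊞ j = combine (quot i ⊕ quot j) (rem i ⊕ rem j)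
  k ⊟ i = combine (quot k ⊖ quot i) (rem k ⊖ rem i)

  quot-combine : ∀ (u : Fin (2+ a)) (v : Fin (2+ b)) → quot (combine u v) ≡ u
  quot-combine u v = cong proj₁ (remQuot-combine u v)

  rem-combine : ∀ (u : Fin (2+ a)) (v : Fin (2+ b)) → rem (combine u v) ≡ v
  rem-combine u v = cong proj₂ (remQuot-combine u v)

  combine-quot-rem : ∀ {u : Fin (2+ a)} {v : Fin (2+ b)} i → u ≡ quot i → v ≡ rem i → combine u v ≡ i
  combine-quot-rem i refl refl = combine-remQuot {2+ a} (2+ b) i

  ⊞-comm : ∀ i j → i ⊞ j ≡ j ⊞ i
  ⊞-comm i j = cong₂ combine (⊕-comm (quot i) (quot j)) (⊕-comm (rem i) (rem j))

  ⊞-⊟ : ∀ i k → i ⊞ (k ⊟ i) ≡ k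
  ⊞-⊟ i k = combine-quot-rem k
    (trans (cong (quot i ⊕_) (quot-combine (quot k ⊖ quot i) (rem k ⊖ rem i)))
      (⊕-⊖ (quot i) (quot k)))
    (trans (cong (rem i ⊕_) (rem-combine (quot k ⊖ quot i) (rem k ⊖ rem i)))
      (⊕-⊖ (rem i) (rem k)))

  ⊟-⊞ : ∀ i j → i ⊞ j ⊟ i ≡ j
  ⊟-⊞ i j = combine-quot-rem j
    (trans (cong (_⊖ quot i) (quot-combine (quot i ⊕ quot j) (rem i ⊕ rem j)))
      (⊖-⊕ (quot i) (quot j)))
    (trans (cong (_⊖ rem i) (rem-combine (quot i ⊕ quot j) (rem i ⊕ rem j)))
      (⊖-⊕ (rem i) (rem j)))

  ⊞-identityʳ : ∀ i → i ⊞ zero ≡ i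
  -- `quot zero` and `rem zero` compute to `zero`, so index 0 is the neutral element.
  ⊞-identityʳ i = combine-quot-rem i (⊕-identityʳ (quot i)) (⊕-identityʳ (rem i))

  L : Matrix ℕ (2+ a ℕ.* 2+ b)
  L = table _⊞_ (λ i k → k ⊟ i) ⊞-comm ⊞-⊟ ⊟-⊞

  L-isLatinSquare : IsLatinSquare L
  L-isLatinSquare = table-isLatinSquare _⊞_ (λ i k → k ⊟ i) ⊞-comm ⊞-⊟ ⊟-⊞

  L-isNormalized : IsNormalized L
  L-isNormalized i zero _ = cong (suc ∘ toℕ) (⊞-identityʳ i)

  L-combine : ∀ i (u : Fin (2+ a)) (v : Fin (2+ b)) →
    L i (combine u v) ≡ suc (2+ b ℕ.* toℕ (quot i ⊕ u) ℕ.+ toℕ (rem i ⊕ v))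
  L-combine i u v = cong suc (trans
    (toℕ-combine (quot i ⊕ quot (combine u v)) (rem i ⊕ rem (combine u v)))
    (cong₂ (λ x y → 2+ b ℕ.* toℕ (quot i ⊕ x) ℕ.+ toℕ (rem i ⊕ y))
      (quot-combine u v) (rem-combine u v)))

  L-columns : ∀ i (u : Fin (2+ a)) (v : Fin (2+ b)) (u′ : Fin (2+ a)) (v′ : Fin (2+ b)) →
    L i (combine u v) ℕ.+ L i (combine u′ v′) ≡ L i (combine u v′) ℕ.+ L i (combine u′ v)
  L-columns i u v u′ v′ = begin
    L i (combine u v) ℕ.+ L i (combine u′ v′)  ≡⟨ cong₂ ℕ._+_ (L-combine i u v) (L-combine i u′ v′) ⟩
    suc (f u ℕ.+ g v) ℕ.+ suc (f u′ ℕ.+ g v′)  ≡⟨ regroup (f u) (f u′) (g v) (g v′) ⟩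
    suc (f u ℕ.+ g v′) ℕ.+ suc (f u′ ℕ.+ g v)  ≡⟨ cong₂ ℕ._+_ (L-combine i u v′) (L-combine i u′ v) ⟨
    L i (combine u v′) ℕ.+ L i (combine u′ v)  ∎
    where
    open ≡-Reasoning

    f : Fin (2+ a) → ℕ
    f x = 2+ b ℕ.* toℕ (quot i ⊕ x)

    g : Fin (2+ b) → ℕ
    g y = toℕ (rem i ⊕ y)

    regroup : ∀ x x′ y y′ →
      suc (x ℕ.+ y) ℕ.+ suc (x′ ℕ.+ y′) ≡ suc (x ℕ.+ y′) ℕ.+ suc (x′ ℕ.+ y)
    regroup = ℕSolver.solve-∀

  L-isSingular : IsSingular L
  L-isSingular = det-dependent-columns (λ i j → + L i j)
    -- The columns (0,1), (1,0) and (1,1) with their leading `suc` removed: column (1,v) lies `2+ b`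
    -- places after (0,v), hence the shift by `suc b`.
    zero
    (suc b ↑ʳ combine {suc a} {2+ b} zero zero)
    (suc b ↑ʳ combine {suc a} {2+ b} zero (suc zero))
    λ i → cong +_ (L-columns i zero zero (suc zero) (suc zero))

mainTheorem5 : (n : ℕ) → Composite n →
    Σ (Matrix ℕ n) (λ L → IsLatinSquare L × IsNormalized L × IsSingular L)
-- The cofactor must be at least 2: cofactor 0 would give `n` equal to 0 and cofactor 1 would give
-- `n` equal to `d`, both against `d<n`.
mainTheorem5 n (hasNonTrivialDivisor d<n (divides zero refl)) = ⊥-elim (ℕₚ.n≮0 d<n)
mainTheorem5 n (hasNonTrivialDivisor {d} d<n (divides 1 refl)) =
  ⊥-elim (ℕₚ.<-irrefl (sym (ℕₚ.*-identityˡ d)) d<n)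
mainTheorem5 n (hasNonTrivialDivisor {2+ b} d<n (divides (2+ a) refl)) =
  L , L-isLatinSquare , L-isNormalized , L-isSingular
  where open Product a b
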